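{- Let $\langle O,\sqsubseteq,\triangleleft\rangle$ be a directed observation structure over a set $\mathbb{B}$, let $P\subseteq\mathbb{B}$ be a property and $o\in O$. Then $\mathcal{M}_P(o)=\mathsf{no}$ if and only if $\mathcal{M}_{\Gamma_{\mathbb{S}}(P)}(o)=\mathsf{no}$.
   Context: Let $\mathbb{B}$ be a set (of behaviours). A property is a subset $P\subseteq\mathbb{B}$. An observation structure over $\mathbb{B}$ is a preordered set $\langle O,\sqsubseteq\rangle$ (of observations) together with a relation $\triangleleft\subseteq O\times\mathbb{B}$ such that: (i) $o\sqsubseteq o'$ and $o'\triangleleft b$ imply $o\triangleleft b$; (ii) for every $o\in O$ there is $b\in\mathbb{B}$ with $o\triangleleft b$. It is directed if for all $o,o'\in O$ and $b\in\mathbb{B}$ with $o\triangleleft b$ and $o'\triangleleft b$ there is $o''\in O$ with $o''\triangleleft b$, $o\sqsubseteq o''$ and $o'\sqsubseteq o''$. Put $\mathbb{B}(o)=\{b\in\mathbb{B}\mid o\triangleleft b\}$. The abstract monitor of $P$ is the function $\mathcal{M}_P:O\to\{\mathsf{yes},\mathsf{no},\mathsf{?}\}$ with $\mathcal{M}_P(o)=\mathsf{yes}$ if $\mathbb{B}(o)\subseteq P$, $\mathcal{M}_P(o)=\mathsf{no}$ if $\mathbb{B}(o)\cap P=\emptyset$, and $\mathcal{M}_P(o)=\mathsf{?}$ otherwise. $P$ is a safety property if for every $b\in\mathbb{B}\setminus P$ there is $o\in O$ with $o\triangleleft b$ and $\mathcal{M}_P(o)=\mathsf{no}$. Let $\mathbb{S}$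 be the set of all safety properties over $\mathbb{B}$. The safety completion of $P$ is $\Gamma_{\mathbb{S}}(P)=\bigcap\{Q\in\mathbb{S}\mid P\subseteq Q\}$. -}

module Defs where

open import Axiom.ExcludedMiddle using (ExcludedMiddle)
open import Data.Product using (Σ; ∃-syntax; _×_; proj₁)
open import Level using (Level; _⊔_; suc)
open import Relation.Binary using (REL; Rel; IsPreorder)
open import Relation.Binary.PropositionalEquality using (_≡_)
open import Relation.Nullary using (yes; no)
open import Relation.Unary using (Pred; _∈_; _∉_; _⊆_; _∩_; Empty; ⋂)

record ObservationStructure {b} (𝔹 : Set b) (a ℓ₁ ℓ₂ : Level)
    : Set (b ⊔ suc (a ⊔ ℓ₁ ⊔ ℓ₂)) where
  infix 4 _⊑_ _◁_
  field
    O          : Set a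
    _⊑_        : Rel O ℓ₁
    isPreorder : IsPreorder _≡_ _⊑_
    _◁_        : REL O 𝔹 ℓ₂
    ◁-downward : ∀ {o o′ b} → o ⊑ o′ → o′ ◁ b → o ◁ b
    ◁-total    : ∀ o → ∃[ b ] o ◁ b

  𝔹⟨_⟩ : O → Pred 𝔹 ℓ₂
  𝔹⟨ o ⟩ b = o ◁ b

  Directed : Set (b ⊔ a ⊔ ℓ₁ ⊔ ℓ₂)
  Directed = ∀ {o o′ b} → o ◁ b → o′ ◁ b →
             ∃[ o″ ] (o″ ◁ b × o ⊑ o″ × o′ ⊑ o″)

data Verdict : Set where
  Yes No Unknown : Verdict

-- The abstract monitor is a total function defined by cases on arbitrary
-- propositions, so excluded middle is assumed, at every level.
module Monitoring
  (em : ∀ {ℓ} → ExcludedMiddle ℓ)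
  {b a ℓ₁ ℓ₂ : Level} {𝔹 : Set b}
  (S : ObservationStructure 𝔹 a ℓ₁ ℓ₂)
  where

  open ObservationStructure S

  -- The first two cases exclude each other by ◁-total, so the order in which
  -- they are tried is immaterial.
  ℳ : ∀ {ℓ} → Pred 𝔹 ℓ → O → Verdict
  ℳ P o with em {P = 𝔹⟨ o ⟩ ⊆ P} | em {P = Empty (𝔹⟨ o ⟩ ∩ P)}
  ... | yes _ | _     = Yes
  ... | no  _ | yes _ = No
  ... | no  _ | no  _ = Unknown

  Safety : ∀ {ℓ} → Pred 𝔹 ℓ → Set (b ⊔ a ⊔ ℓ₂ ⊔ ℓ)
  Safety P = ∀ b → b ∉ P → ∃[ o ] (o ◁ b × ℳ P o ≡ No)

  𝕊 : ∀ ℓ → Pred (Pred 𝔹 ℓ) (b ⊔ a ⊔ ℓ₂ ⊔ ℓ)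
  𝕊 ℓ Q = Safety Q

  -- The intersection ranges over properties at the level of P.  By em every
  -- predicate is equivalent to one at any given level, so no property is
  -- missed, although the intersection itself lives at a higher level.
  Γ𝕊 : ∀ {ℓ} → Pred 𝔹 ℓ → Pred 𝔹 (b ⊔ a ⊔ ℓ₂ ⊔ suc ℓ)
  Γ𝕊 {ℓ} P = ⋂ (Σ (Pred 𝔹 ℓ) λ Q → Q ∈ 𝕊 ℓ × P ⊆ Q) proj₁

{-# OPTIONS --safe #-}

-- If P is disjoint from 𝔹(o), then the complement of 𝔹(o) is a property
-- containing P, and it is a safety property since o itself refutes it on every
-- behaviour of 𝔹(o).  Hence it contains Γ𝕊 P, which is therefore disjoint from
-- 𝔹(o) too.  The converse holds because P ⊆ Γ𝕊 P.

module Submission where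

open import Defs
open import Axiom.ExcludedMiddle using (ExcludedMiddle)
open import Data.Product using (_,_)
open import Function.Base using (_∘_)
open import Function.Bundles using (_⇔_; mk⇔; module Equivalence)
open import Level using (Lift; lift; lower)
open import Relation.Binary.PropositionalEquality using (_≡_; refl)
open import Relation.Nullary using (yes; no; contradiction)
open import Relation.Nullary.Decidable
  using (False; fromWitnessFalse; toWitnessFalse; decidable-stable)
open import Relation.Unary using (Pred; _∈_; _⊆_; _∩_; Empty)

module MonitoringProperties
  (em : ∀ {ℓ} → ExcludedMiddle ℓ)
  {b a ℓ₁ ℓ₂} {𝔹 : Set b} (S : ObservationStructure 𝔹 a ℓ₁ ℓ₂)
  where

  open ObservationStructure S
  open Monitoring em S

  -- Trades verdicts for plain set disjointness, so that later arguments need not unfold `ℳ`.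
  ℳ≡No⇔disjoint : ∀ {ℓ} (P : Pred 𝔹 ℓ) o →
                  (ℳ P o ≡ No) ⇔ Empty (𝔹⟨ o ⟩ ∩ P)
  ℳ≡No⇔disjoint P o = mk⇔ to from
    where
    to : ℳ P o ≡ No → Empty (𝔹⟨ o ⟩ ∩ P)
    to eq with em {P = 𝔹⟨ o ⟩ ⊆ P} | em {P = Empty (𝔹⟨ o ⟩ ∩ P)}
    to () | yes _ | _
    to _  | no _  | yes disjoint = disjoint
    to () | no _  | no _

    from : Empty (𝔹⟨ o ⟩ ∩ P) → ℳ P o ≡ No
    from disjoint with em {P = 𝔹⟨ o ⟩ ⊆ P} | em {P = Empty (𝔹⟨ o ⟩ ∩ P)}
    -- `Yes` takes precedence in `ℳ`, but cannot arise here: `◁-total` makes `𝔹⟨ o ⟩` inhabited, so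
    -- it is not both inside `P` and disjoint from it.
    ... | yes 𝔹⟨o⟩⊆P | _ = let b , o◁b = ◁-total o in
                           contradiction (o◁b , 𝔹⟨o⟩⊆P o◁b) (disjoint b)
    ... | no _ | yes _ = refl
    ... | no _ | no ¬disjoint = contradiction disjoint ¬disjoint

  P⊆Γ𝕊P : ∀ {ℓ} (P : Pred 𝔹 ℓ) → P ⊆ Γ𝕊 P
  P⊆Γ𝕊P P b∈P (Q , Q∈𝕊 , P⊆Q) = P⊆Q b∈P

  -- Stated through False so as to live at an arbitrary level ℓ: the properties
  -- over which Γ𝕊 P ranges are at the level of P.
  Refuted : ∀ ℓ → O → Pred 𝔹 ℓ
  Refuted ℓ o b = Lift ℓ (False (em {P = o ◁ b}))

  Refuted-disjoint : ∀ ℓ o → Empty (𝔹⟨ o ⟩ ∩ Refuted ℓ o)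
  Refuted-disjoint ℓ o b (o◁b , b∈R) = toWitnessFalse (lower b∈R) o◁b

  Refuted-safety : ∀ ℓ o → Refuted ℓ o ∈ 𝕊 ℓ
  Refuted-safety ℓ o b b∉R =
    -- `b∉R` only shows that `o ◁ b` is irrefutable; excluded middle removes the double negation.
    o , decidable-stable em (b∉R ∘ lift ∘ fromWitnessFalse) ,
    Equivalence.from (ℳ≡No⇔disjoint (Refuted ℓ o) o) (Refuted-disjoint ℓ o)

  disjoint⇒Γ𝕊-disjoint : ∀ {ℓ} (P : Pred 𝔹 ℓ) o →
                         Empty (𝔹⟨ o ⟩ ∩ P) → Empty (𝔹⟨ o ⟩ ∩ Γ𝕊 P)
  disjoint⇒Γ𝕊-disjoint {ℓ} P o disjoint b (o◁b , b∈Γ) =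
    -- Instantiating the intersection at `Refuted ℓ o` puts `b` outside `𝔹⟨ o ⟩`, against `o◁b`.
    Refuted-disjoint ℓ o b
      (o◁b , b∈Γ (Refuted ℓ o , Refuted-safety ℓ o , P⊆Refuted))
    where
    P⊆Refuted : P ⊆ Refuted ℓ o
    P⊆Refuted {b} b∈P = lift (fromWitnessFalse λ o◁b → disjoint b (o◁b , b∈P))

theorem1 : (em : ∀ {ℓ} → ExcludedMiddle ℓ) →
    ∀ {b a ℓ₁ ℓ₂ ℓ} {𝔹 : Set b} (S : ObservationStructure 𝔹 a ℓ₁ ℓ₂) →
    let open ObservationStructure S
        open Monitoring em S in
    Directed → (P : Pred 𝔹 ℓ) (o : O) →
    (ℳ P o ≡ No) ⇔ (ℳ (Γ𝕊 P) o ≡ No)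
theorem1 em S _ P o = mk⇔
  (Γ.from ∘ disjoint⇒Γ𝕊-disjoint P o ∘ P.to)
  -- Disjointness is antitone in the property.
  (λ eq → P.from λ b (o◁b , b∈P) → Γ.to eq b (o◁b , P⊆Γ𝕊P P b∈P))
  where
  open Monitoring em S
  open MonitoringProperties em S
  module P = Equivalence (ℳ≡No⇔disjoint P o)
  module Γ = Equivalence (ℳ≡No⇔disjoint (Γ𝕊 P) o)
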